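{- For any finite simple connected graph $G$ and any $\ell\ge 2$, either $c'_\ell(G)=c_\ell(G)$ or $c(G)\le c_\ell(G)\le c(G)+1$.
   Context: $\ell$-visibility Cops and Robber on a graph $G$: in round 0 a set of cops each choose a vertex, then a single robber chooses a vertex. In each subsequent round, every cop moves to a neighbouring vertex or stays put, and then the robber moves to a neighbouring vertex or stays put. The robber always knows the positions of all cops. The cops know the robber's position only at moments when some cop and the robber occupy vertices $x,y$ with $d(x,y)\le \ell$. The cops capture the robber if a cop occupies the robber's vertex. $c_\ell(G)$ is the minimum number of cops that can guarantee capture; $c'_\ell(G)$ is the minimum number of cops that can guarantee that at some moment some cop is within distance $\ell$ of the robber; $c(G)$ is the classical cop number (cops always know the robber's position). -}

module Defs where

open import Data.Nat using (ℕ; zero; suc; _≤_)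
open import Data.Bool using (Bool; true; false; _∨_; _∧_; T; if_then_else_)
open import Data.Fin using (Fin; _≟_)
open import Data.List as L using (List; []; _∷_; _++_)
open import Data.Vec using (Vec; lookup; toList)
open import Data.Vec.Membership.Propositional using (_∈_)
open import Data.Bool.ListAction using (any)
open import Data.Maybe using (Maybe; just; nothing)
open import Data.Product using (Σ; ∃; _×_; _,_; proj₁; proj₂)
open import Data.Sum using (_⊎_)
open import Relation.Nullary.Decidable using (⌊_⌋)
open import Relation.Binary.PropositionalEquality using (_≡_)

record Graph : Set where
  field
    n      : ℕ
    adj    : Fin n → Fin n → Bool
    sym    : ∀ x y → adj x y ≡ adj y x
    irrefl : ∀ x → adj x x ≡ false

module _ (G : Graph) where
  open Graph G

  -- near l x y = true  iff  there is a walk of length ≤ l from x to y,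
  -- i.e. d(x,y) ≤ l.
  near : ℕ → Fin n → Fin n → Bool
  near zero    x y = ⌊ x ≟ y ⌋
  near (suc l) x y = near l x y ∨ any (λ z → near l x z ∧ adj z y) (L.allFin n)

  Connected : Set
  Connected = (1 ≤ n) × (∀ x y → ∃ λ l → T (near l x y))

  Step : Fin n → Fin n → Set
  Step x y = x ≡ y ⊎ T (adj x y)

  CopStep : ∀ {k} → Vec (Fin n) k → Vec (Fin n) k → Set
  CopStep C C' = ∀ i → Step (lookup C i) (lookup C' i)

  anyNear : ℕ → ∀ {k} → Vec (Fin n) k → Fin n → Bool
  anyNear l C r = any (λ c → near l c r) (toList C)

  Observer : Set
  Observer = ∀ {k} → Vec (Fin n) k → Fin n → Maybe (Fin n)

  visObs : ℕ → Observer
  visObs l C r = if anyNear l C r then just r else nothing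

  fullObs : Observer
  fullObs C r = just r

  record Strategy (k : ℕ) : Set where
    field
      start : Vec (Fin n) k
      move  : List (Maybe (Fin n)) → Vec (Fin n) k → Vec (Fin n) k
      legal : ∀ h C → CopStep C (move h C)

  -- A robber trajectory: ρ t = robber position after round t.
  RobberWalk : Set
  RobberWalk = Σ (ℕ → Fin n) λ ρ → ∀ t → Step (ρ t) (ρ (suc t))

  -- state t = (observations at all moments up to and including the robber's
  -- move in round t, cop positions in round t)
  state : Observer → ∀ {k} → Strategy k → (ℕ → Fin n) → ℕ
        → List (Maybe (Fin n)) × Vec (Fin n) k
  state obs σ ρ zero = (obs (Strategy.start σ) (ρ zero) ∷ []) , Strategy.start σ
  state obs σ ρ (suc t) =
    let h  = proj₁ (state obs σ ρ t)
        C  = proj₂ (state obs σ ρ t)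
        C' = Strategy.move σ h C
    in (h ++ (obs C' (ρ t) ∷ obs C' (ρ (suc t)) ∷ [])) , C'

  cops : Observer → ∀ {k} → Strategy k → (ℕ → Fin n) → ℕ → Vec (Fin n) k
  cops obs σ ρ t = proj₂ (state obs σ ρ t)

  -- capture: after the cops' move or after the robber's move, a cop is on the robber
  Captures : Observer → ∀ {k} → Strategy k → (ℕ → Fin n) → Set
  Captures obs σ ρ = ∃ λ t → (ρ t ∈ cops obs σ ρ t) ⊎ (ρ t ∈ cops obs σ ρ (suc t))

  SeesWithin : ℕ → ∀ {k} → Strategy k → (ℕ → Fin n) → Set
  SeesWithin l σ ρ = ∃ λ t → T (anyNear l (cops (visObs l) σ ρ t) (ρ t))
                            ⊎ T (anyNear l (cops (visObs l) σ ρ (suc t)) (ρ t))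

  CanCapture : Observer → ℕ → Set
  CanCapture obs k = Σ (Strategy k) λ σ → (w : RobberWalk) → Captures obs σ (proj₁ w)

  CanSee : ℕ → ℕ → Set
  CanSee l k = Σ (Strategy k) λ σ → (w : RobberWalk) → SeesWithin l σ (proj₁ w)

IsMin : (ℕ → Set) → ℕ → Set
IsMin P k = P k × (∀ j → P j → k ≤ j)

IsCopNumber : Graph → ℕ → Set
IsCopNumber G = IsMin (CanCapture G (fullObs G))

IsVisCopNumber : Graph → ℕ → ℕ → Set
IsVisCopNumber G l = IsMin (CanCapture G (visObs G l))

IsVisSeeNumber : Graph → ℕ → ℕ → Set
IsVisSeeNumber G l = IsMin (CanSee G l)

{-# OPTIONS --safe #-}
module Submission where

-- It suffices that k + 1 cops capture with visibility ℓ whenever k + 1 cops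
-- can see the robber and k cops win the classical game: take
-- k + 1 = max (c'ℓ , c + 1).  After the first
-- sighting one cop tails the robber: by stepping towards the last known robber
-- position it is again within ℓ of the robber after the next cop move, so the
-- other k cops can walk to the starting position of the classical strategy and
-- play it.  If the sighting happened right after a cop move, the robber may
-- escape to distance ℓ + 1, and the positions known when the cops move lag one
-- round behind.  The classical strategy then catches the previous position of
-- the robber, which puts a cop within distance 2 ≤ ℓ of the robber after the
-- robber's next move.  From then on this cop tails without any lag, and the
-- others play the classical strategy against the actual robber.

open import Defs
open import Data.Nat using (ℕ; zero; suc; _≤_; _+_; _⊔_; s≤s; _≤?_; _≤′_; ≤′-refl; ≤′-step)
open import Data.Nat.Properties using (≤-trans; ≤-antisym; +-comm; m≤n+m; m≤m⊔n; m≤n⊔m; ≤⇒≤′; ≰⇒>)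
open import Data.Bool using (Bool; true; false; T)
open import Data.Bool.ListAction using (any)
open import Data.Bool.Properties using (T?; T-∨; T-∧)
open import Data.Fin using (Fin; zero; suc; _≟_)
open import Data.Fin.Properties using (any?)
open import Data.List as L using (List; []; _∷_; _++_)
open import Data.List.Membership.Propositional using (lose)
open import Data.List.Membership.Propositional.Properties using (∈-allFin)
open import Data.List.Relation.Unary.Any using (satisfied)
open import Data.List.Relation.Unary.Any.Properties using (any⁺; any⁻)
open import Data.Vec using (Vec; []; _∷_; lookup; toList; zipWith; insertAt; removeAt)
open import Data.Vec.Membership.Propositional using (_∈_)
open import Data.Vec.Relation.Unary.Any using (here; there; index)
open import Data.Vec.Relation.Unary.Any.Properties using (lookup-index)
open import Data.Vec.Properties using (lookup-zipWith; insertAt-lookup; removeAt-insertAt)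
open import Data.Maybe using (Maybe; just; nothing)
open import Data.Product using (∃; _×_; _,_; proj₁; proj₂)
open import Data.Sum using (_⊎_; inj₁; inj₂; map₂; [_,_]′)
import Data.Sum as Sum
open import Data.Empty using (⊥-elim)
open import Function using (_∘_)
open import Function.Bundles using (Equivalence)
open import Relation.Nullary using (¬_; Dec; yes; no)
open import Relation.Nullary.Decidable using (_×-dec_; _⊎-dec_; toWitness; fromWitness)
open import Relation.Binary.PropositionalEquality using (_≡_; refl; sym; trans; cong; cong₂; subst)

-- Monotone families and vectors.

uniform-bound : ∀ {n} (P : Fin n → ℕ → Set) → (∀ x {l l'} → l ≤ l' → P x l → P x l')
              → (∀ x → ∃ (P x)) → ∃ λ N → ∀ x → P x N
uniform-bound {zero}  P mono f = 0 , λ ()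
uniform-bound {suc n} P mono f with f zero | uniform-bound (P ∘ suc) (λ x → mono (suc x)) (f ∘ suc)
... | l , p | N , q = l ⊔ N , λ { zero → mono zero (m≤m⊔n l N) p ; (suc x) → mono (suc x) (m≤n⊔m l N) (q x) }

upward : (P : ℕ → Set) → (∀ {k} → P k → P (suc k)) → ∀ {k k'} → k ≤ k' → P k → P k'
upward P next {k} k≤k' p = go (≤⇒≤′ k≤k')
  where
  go : ∀ {k'} → k ≤′ k' → P k'
  go ≤′-refl     = p
  go (≤′-step q) = next (go q)

∈-removeAt : ∀ {A : Set} {k} {x : A} (xs : Vec A (suc k)) i → x ∈ removeAt xs i → x ∈ xs
∈-removeAt (x ∷ xs)         zero    p         = there p
∈-removeAt (x ∷ xs@(_ ∷ _)) (suc i) (here p)  = here p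
∈-removeAt (x ∷ xs@(_ ∷ _)) (suc i) (there p) = there (∈-removeAt xs i p)

lookup-injective : ∀ {A : Set} {k} (xs ys : Vec A k) → (∀ i → lookup xs i ≡ lookup ys i) → xs ≡ ys
lookup-injective []       []       p = refl
lookup-injective (x ∷ xs) (y ∷ ys) p = cong₂ _∷_ (p zero) (lookup-injective xs ys (p ∘ suc))

any-lookup⁺ : ∀ {A : Set} {k} (p : A → Bool) (xs : Vec A k) i → T (p (lookup xs i)) → T (any p (toList xs))
any-lookup⁺ p (x ∷ xs) zero    px = Equivalence.from T-∨ (inj₁ px)
any-lookup⁺ p (x ∷ xs) (suc i) px = Equivalence.from T-∨ (inj₂ (any-lookup⁺ p xs i px))

any-lookup⁻ : ∀ {A : Set} {k} (p : A → Bool) (xs : Vec A k) → T (any p (toList xs)) → ∃ λ i → T (p (lookup xs i))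
any-lookup⁻ p (x ∷ xs) q with Equivalence.to T-∨ q
... | inj₁ px = zero , px
... | inj₂ q' = let i , pi = any-lookup⁻ p xs q' in suc i , pi

module _ (G : Graph) where
  open Graph G using (n; adj)

  -- Distance balls, greedy moves and observations.

  near-refl : ∀ l x → T (near G l x x)
  near-refl zero    x = fromWitness refl
  near-refl (suc l) x = Equivalence.from T-∨ (inj₁ (near-refl l x))

  near-zero : ∀ {x y} → T (near G 0 x y) → x ≡ y
  near-zero = toWitness

  near-suc⁻ : ∀ l {x y} → T (near G (suc l) x y) → ∃ λ z → T (near G l x z) × Step G z y
  near-suc⁻ l {x} {y} p with Equivalence.to T-∨ p
  ... | inj₁ q = y , q , inj₁ refl
  ... | inj₂ q with satisfied (any⁻ _ (L.allFin n) q)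
  ...   | z , r = let a , b = Equivalence.to T-∧ r in z , a , inj₂ b

  near-step : ∀ l {x y z} → T (near G l x y) → Step G y z → T (near G (suc l) x z)
  near-step l p (inj₁ refl) = Equivalence.from T-∨ (inj₁ p)
  near-step l {y = y} p (inj₂ a) =
    Equivalence.from T-∨ (inj₂ (any⁺ _ (lose (∈-allFin y) (Equivalence.from T-∧ (p , a)))))

  near-mono : ∀ {l l' x y} → l ≤ l' → T (near G l x y) → T (near G l' x y)
  near-mono {x = x} {y} = upward (λ l → T (near G l x y)) (λ {l} p → near-step l p (inj₁ refl))

  -- `near` grows a walk at its far end, whereas a cop approaching a target needs the first edge;
  -- induction carries the last edge over.
  near-first : ∀ l {x y} → T (near G (suc l) x y) → ∃ λ z → Step G x z × T (near G l z y)
  near-first l p with near-suc⁻ l p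
  near-first zero    {y = y} p | w , q , s with near-zero q
  ... | refl = y , s , near-refl 0 y
  near-first (suc l) p | w , q , s with near-first l q
  ... | z , s' , r = z , s' , near-step l r s

  step? : ∀ x y → Dec (Step G x y)
  step? x y = (x ≟ y) ⊎-dec T? (adj x y)

  closer? : ∀ l x y → Dec (∃ λ z → Step G x z × T (near G l z y))
  closer? l x y = any? (λ z → step? x z ×-dec T? (near G l z y))

  toward : ℕ → Fin n → Fin n → Fin n
  toward l x y with closer? l x y
  ... | yes (z , _) = z
  -- Staying put keeps the move legal even when the target is too far away.
  ... | no  _       = x

  toward-step : ∀ l x y → Step G x (toward l x y)
  toward-step l x y with closer? l x y
  ... | yes (z , s , _) = s
  ... | no  _           = inj₁ refl

  toward-near : ∀ l x y → T (near G (suc l) x y) → T (near G l (toward l x y) y)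
  toward-near l x y p with closer? l x y
  ... | yes (z , _ , q) = q
  ... | no  ¬q          = ⊥-elim (¬q (near-first l p))

  anyNear⁺ : ∀ l {k} (C : Vec (Fin n) k) i {r} → T (near G l (lookup C i) r) → T (anyNear G l C r)
  anyNear⁺ l C i {r} = any-lookup⁺ (λ c → near G l c r) C i

  ∈⇒near : ∀ l {k r} {C : Vec (Fin n) k} (p : r ∈ C) → T (near G l (lookup C (index p)) r)
  ∈⇒near l {r = r} p = subst (λ x → T (near G l x r)) (lookup-index p) (near-refl l r)

  ∈⇒anyNear : ∀ l {k r} {C : Vec (Fin n) k} → r ∈ C → T (anyNear G l C r)
  ∈⇒anyNear l {C = C} p = anyNear⁺ l C (index p) (∈⇒near l p)

  visObs-seen : ∀ l {k} (C : Vec (Fin n) k) {r} → T (anyNear G l C r) → visObs G l C r ≡ just r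
  visObs-seen l C {r} p with anyNear G l C r
  ... | true = refl

  visObs-unseen : ∀ l {k} (C : Vec (Fin n) k) {r} → ¬ T (anyNear G l C r) → visObs G l C r ≡ nothing
  visObs-unseen l C {r} ¬p with anyNear G l C r
  ... | true  = ⊥-elim (¬p _)
  ... | false = refl

  insertAt-legal : ∀ {m} (C : Vec (Fin n) (suc m)) D i {v} → CopStep G (removeAt C i) D
                 → Step G (lookup C i) v → CopStep G C (insertAt D i v)
  insertAt-legal (c ∷ C)         D       zero    p s zero    = s
  insertAt-legal (c ∷ C)         D       zero    p s (suc j) = p j
  insertAt-legal (c ∷ C@(_ ∷ _)) (d ∷ D) (suc i) p s zero    = p zero
  insertAt-legal (c ∷ C@(_ ∷ _)) (d ∷ D) (suc i) p s (suc j) = insertAt-legal C D i (p ∘ suc) s j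

  Obs : Set
  Obs = Maybe (Fin n)

  -- Adding an idle cop

  addIdle : ∀ {k} → Fin n → Strategy G k → Strategy G (suc k)
  addIdle c σ = record
    { start = c ∷ start
    ; move  = λ { h (d ∷ C) → d ∷ move h C }
    ; legal = λ { h (d ∷ C) zero → inj₁ refl ; h (d ∷ C) (suc i) → legal h C i }
    }
    where open Strategy σ

  withIdle : ∀ {k} → Fin n → List Obs × Vec (Fin n) k → List Obs × Vec (Fin n) (suc k)
  withIdle c (h , C) = h , c ∷ C

  addIdle-full : ∀ {k} c (σ : Strategy G k) ρ t
               → state G (fullObs G) (addIdle c σ) ρ t ≡ withIdle c (state G (fullObs G) σ ρ t)
  addIdle-full c σ ρ zero    = refl
  addIdle-full c σ ρ (suc t) rewrite addIdle-full c σ ρ t = refl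

  canCapture-suc : ∀ {k} → Fin n → CanCapture G (fullObs G) k → CanCapture G (fullObs G) (suc k)
  canCapture-suc c (σ , wins) = addIdle c σ , λ w → captures (proj₁ w) (wins w)
    where
    captures : ∀ ρ → Captures G (fullObs G) σ ρ → Captures G (fullObs G) (addIdle c σ) ρ
    captures ρ (t , p) = t , Sum.map (transfer t) (transfer (suc t)) p
      where
      transfer : ∀ s {r} → r ∈ cops G (fullObs G) σ ρ s → r ∈ cops G (fullObs G) (addIdle c σ) ρ s
      transfer s q = subst (_ ∈_) (sym (cong proj₂ (addIdle-full c σ ρ s))) (there q)

  -- The idle cop alters an observation only by being near the robber, which is already a sighting.
  -- Until then the games with and without it share their history.
  visObs-idle : ∀ l {k} c (C : Vec (Fin n) k) r → T (anyNear G l (c ∷ C) r) ⊎ visObs G l (c ∷ C) r ≡ visObs G l C r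
  visObs-idle l c C r with near G l c r
  ... | true  = inj₁ _
  ... | false = inj₂ refl

  canSee-suc : ∀ {l k} → Fin n → CanSee G l k → CanSee G l (suc k)
  canSee-suc {l} {k} c (σ , wins) = addIdle c σ , λ w → sees (proj₁ w) (wins w)
    where
    σ⁺ : Strategy G (suc k)
    σ⁺ = addIdle c σ

    extend : (ℕ → Fin n) → ℕ → List Obs × Vec (Fin n) (suc k) → List Obs × Vec (Fin n) (suc k)
    extend ρ t (h , C) = (h ++ visObs G l C' (ρ t) ∷ visObs G l C' (ρ (suc t)) ∷ []) , C'
      where
      C' : Vec (Fin n) (suc k)
      C' = Strategy.move σ⁺ h C

    agree : ∀ ρ t → SeesWithin G l σ⁺ ρ ⊎ state G (visObs G l) σ⁺ ρ t ≡ withIdle c (state G (visObs G l) σ ρ t)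
    agree ρ zero with visObs-idle l c (Strategy.start σ) (ρ 0)
    ... | inj₁ p = inj₁ (0 , inj₁ p)
    ... | inj₂ e = inj₂ (cong (λ o → o ∷ [] , c ∷ Strategy.start σ) e)
    agree ρ (suc t) with agree ρ t
    ... | inj₁ p = inj₁ p
    ... | inj₂ e with visObs-idle l c (cops G (visObs G l) σ ρ (suc t)) (ρ t)
                    | visObs-idle l c (cops G (visObs G l) σ ρ (suc t)) (ρ (suc t))
    ...   | inj₁ p | _      = inj₁ (t , inj₂ (subst (λ s → T (anyNear G l (proj₂ (extend ρ t s)) (ρ t))) (sym e) p))
    ...   | inj₂ _ | inj₁ p =
      inj₁ (suc t , inj₁ (subst (λ s → T (anyNear G l (proj₂ (extend ρ t s)) (ρ (suc t)))) (sym e) p))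
    ...   | inj₂ a | inj₂ b = inj₂ (trans (cong (extend ρ t) e)
      (cong₂ (λ o o' → (proj₁ (state G (visObs G l) σ ρ t) ++ o ∷ o' ∷ []) , c ∷ cops G (visObs G l) σ ρ (suc t)) a b))

    sees : ∀ ρ → SeesWithin G l σ ρ → SeesWithin G l σ⁺ ρ
    sees ρ (t , inj₁ p) with agree ρ t
    ... | inj₁ q = q
    ... | inj₂ e = t , inj₁ (subst (λ C → T (anyNear G l C (ρ t))) (sym (cong proj₂ e)) (Equivalence.from T-∨ (inj₂ p)))
    sees ρ (t , inj₂ p) with agree ρ (suc t)
    ... | inj₁ q = q
    ... | inj₂ e = t , inj₂ (subst (λ C → T (anyNear G l C (ρ t))) (sym (cong proj₂ e)) (Equivalence.from T-∨ (inj₂ p)))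

  -- Strategies with internal memory

  record Machine (k : ℕ) : Set₁ where
    field
      Mode   : Set
      start  : Vec (Fin n) k
      init   : Obs → Mode
      move   : Mode → Vec (Fin n) k → Vec (Fin n) k
      legal  : ∀ s C → CopStep G C (move s C)
      -- receives the new cop positions, then the observations before and
      -- after the robber's reply
      update : Mode → Vec (Fin n) k → Obs → Obs → Mode

  -- After the initial observation every round contributes two. On a list of odd length `replay`
  -- would fall out of step with an appended round, so parity is recorded.
  data Paired : List Obs → Set where
    []     : Paired []
    _∷∷_∷_ : ∀ o o' {h} → Paired h → Paired (o ∷ o' ∷ h)

  paired-snoc : ∀ {h} → Paired h → ∀ o o' → Paired (h ++ o ∷ o' ∷ [])
  paired-snoc []           o o' = o ∷∷ o' ∷ []
  paired-snoc (a ∷∷ b ∷ h) o o' = a ∷∷ b ∷ paired-snoc h o o'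

  module _ {k} (M : Machine k) where
    open Machine M

    step : Mode × Vec (Fin n) k → Obs → Obs → Mode × Vec (Fin n) k
    step (s , C) o o' = update s (move s C) o o' , move s C

    -- A `Strategy` is handed observations but no modes. Since a machine is deterministic, modes and
    -- cop positions can be recomputed together from the history.
    replay : Mode × Vec (Fin n) k → List Obs → Mode × Vec (Fin n) k
    replay p (o ∷ o' ∷ h) = replay (step p o o') h
    replay p _            = p

    recall : List Obs → Mode
    -- A default value: histories arising in play begin with the observation at placement.
    recall []      = init nothing
    recall (o ∷ h) = proj₁ (replay (init o , start) h)

    toStrategy : Strategy G k
    toStrategy = record { start = start ; move = move ∘ recall ; legal = legal ∘ recall }

    replay-snoc : ∀ p {h} → Paired h → ∀ o o' → replay p (h ++ o ∷ o' ∷ []) ≡ step (replay p h) o o'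
    replay-snoc p []              o o' = refl
    replay-snoc p (a ∷∷ b ∷ h) o o' = replay-snoc _ h o o'

    module _ (obs : Observer G) where

      stepOn : Mode × Vec (Fin n) k → Fin n → Fin n → Mode × Vec (Fin n) k
      stepOn (s , C) r r' = step (s , C) (obs (move s C) r) (obs (move s C) r')

      stepOn-≡ : ∀ {p s C r r' o o'} → p ≡ (s , C) → obs (move s C) r ≡ o → obs (move s C) r' ≡ o'
               → stepOn p r r' ≡ (update s (move s C) o o' , move s C)
      stepOn-≡ refl refl refl = refl

      run : (ℕ → Fin n) → ℕ → Mode × Vec (Fin n) k
      run ρ zero    = init (obs start (ρ 0)) , start
      run ρ (suc t) = stepOn (run ρ t) (ρ t) (ρ (suc t))

      Replays : (ℕ → Fin n) → ℕ → Set
      Replays ρ t = ∃ λ h → Paired h × proj₁ (state G obs toStrategy ρ t) ≡ obs start (ρ 0) ∷ h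
                          × replay (init (obs start (ρ 0)) , start) h ≡ run ρ t
                          × cops G obs toStrategy ρ t ≡ proj₂ (run ρ t)

      replays : ∀ ρ t → Replays ρ t
      replays ρ zero = [] , [] , refl , refl , refl
      replays ρ (suc t) with replays ρ t
      ... | h , ph , e₁ , e₂ , e₃ rewrite e₁ | e₃ | e₂ =
        let C' = proj₂ (run ρ (suc t)) in
        _ , paired-snoc ph _ _ , refl
          , trans (replay-snoc _ ph _ _) (cong (λ p → step p (obs C' (ρ t)) (obs C' (ρ (suc t)))) e₂) , refl

      run-cops : ∀ ρ t → cops G obs toStrategy ρ t ≡ proj₂ (run ρ t)
      run-cops ρ t = proj₂ (proj₂ (proj₂ (proj₂ (replays ρ t))))

      CapturesRun : (ℕ → Fin n) → (ℕ → Mode × Vec (Fin n) k) → Set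
      CapturesRun ρ R = ∃ λ t → (ρ t ∈ proj₂ (R t)) ⊎ (ρ t ∈ proj₂ (R (suc t)))

      captures-toStrategy : ∀ ρ → CapturesRun ρ (run ρ) → Captures G obs toStrategy ρ
      captures-toStrategy ρ (t , p) =
        t , Sum.map (subst (ρ t ∈_) (sym (run-cops ρ t))) (subst (ρ t ∈_) (sym (run-cops ρ (suc t)))) p

  -- Comparing the visibility, classical and sighting games.

  canCapture-vis⇒full : ∀ {l k} → CanCapture G (visObs G l) k → CanCapture G (fullObs G) k
  canCapture-vis⇒full {l} {k} (σ , wins) =
    toStrategy M , λ w → captures-toStrategy M (fullObs G) (proj₁ w) (captures (proj₁ w) (wins w))
    where
    -- Fully informed cops simulate the restricted ones by erasing the positions that these would
    -- not see.
    hide : Vec (Fin n) k → Obs → Obs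
    hide C (just r) = visObs G l C r
    hide C nothing  = nothing

    M : Machine k
    M = record
      { Mode   = List Obs
      ; start  = Strategy.start σ
      ; init   = λ o → hide (Strategy.start σ) o ∷ []
      ; move   = Strategy.move σ
      ; legal  = Strategy.legal σ
      ; update = λ h C o o' → h ++ hide C o ∷ hide C o' ∷ []
      }

    run-state : ∀ ρ t → run M (fullObs G) ρ t ≡ state G (visObs G l) σ ρ t
    run-state ρ zero    = refl
    run-state ρ (suc t) rewrite run-state ρ t = refl

    captures : ∀ ρ → Captures G (visObs G l) σ ρ → CapturesRun M (fullObs G) ρ (run M (fullObs G) ρ)
    captures ρ (t , p) = t , Sum.map (subst (λ s → ρ t ∈ proj₂ s) (sym (run-state ρ t)))
                                     (subst (λ s → ρ t ∈ proj₂ s) (sym (run-state ρ (suc t)))) p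

  canCapture⇒canSee : ∀ {l k} → CanCapture G (visObs G l) k → CanSee G l k
  canCapture⇒canSee {l} (σ , wins) = σ , λ w → let t , p = wins w in t , Sum.map (∈⇒anyNear l) (∈⇒anyNear l) p

  -- Bounds the diameter, so that the time allowed for gathering does not depend on where the cops
  -- stand.
  uniform-near : Connected G → ∃ λ N → ∀ x y → T (near G N x y)
  uniform-near (_ , conn) = uniform-bound (λ x N → ∀ y → T (near G N x y)) (λ x le p y → near-mono le (p y))
    (λ x → uniform-bound (λ y N → T (near G N x y)) (λ y → near-mono) (conn x))

  -- Tailing with one cop while the others play a classical strategy

  module _ {m} (σ : Strategy G m) (wins : (w : RobberWalk G) → Captures G (fullObs G) σ (proj₁ w)) where

    -- gather d: every other cop is within d + 1 of its starting vertex.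
    -- engaged h: the others play σ and have observed h.
    data Stage : Set where
      gather  : ℕ → Stage
      engaged : List Obs → Stage

    -- The number counts the gathering rounds left. At zero the target's present position becomes
    -- its placement in a new classical game.
    enter : ℕ → Fin n → Stage
    enter zero    r = engaged (just r ∷ [])
    enter (suc d) r = gather d

    next : Stage → Fin n → Fin n → Stage
    next (gather d)  r r' = enter d r'
    next (engaged h) r r' = engaged (h ++ just r ∷ just r' ∷ [])

    others : Stage → Vec (Fin n) m → Vec (Fin n) m
    others (gather d)  D = zipWith (toward d) D (Strategy.start σ)
    others (engaged h) D = Strategy.move σ h D

    others-legal : ∀ q D → CopStep G D (others q D)
    others-legal (gather d)  D j =
      subst (Step G (lookup D j)) (sym (lookup-zipWith (toward d) j D (Strategy.start σ))) (toward-step d _ _)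
    others-legal (engaged h) D = Strategy.legal σ h D

    -- Induction on the gathering time shifts all sequences by one round, hence their description by
    -- recurrences. At zero the cops stand at the start of `σ`, which wins against the remaining
    -- walk.
    others-capture : ∀ d (x : ℕ → Fin n) → (∀ s → Step G (x s) (x (suc s))) → (q : ℕ → Stage) (D : ℕ → Vec (Fin n) m)
                   → q 0 ≡ enter d (x 0) → (∀ s → q (suc s) ≡ next (q s) (x s) (x (suc s)))
                   → (∀ s → D (suc s) ≡ others (q s) (D s))
                   → (∀ j → T (near G d (lookup (D 0) j) (lookup (Strategy.start σ) j)))
                   → ∃ λ s → x s ∈ D s ⊎ x s ∈ D (suc s)
    others-capture zero x walk q D q₀ q₊ D₊ close =
      let s , p = wins (x , walk)
      in s , Sum.map (subst (x s ∈_) (sym (proj₂ (follows s)))) (subst (x s ∈_) (sym (proj₂ (follows (suc s))))) p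
      where
      follows : ∀ s → q s ≡ engaged (proj₁ (state G (fullObs G) σ x s)) × D s ≡ cops G (fullObs G) σ x s
      follows zero    = q₀ , lookup-injective _ _ (λ j → near-zero (close j))
      follows (suc s) with follows s
      ... | e , e' = trans (q₊ s) (cong (λ p → next p (x s) (x (suc s))) e) , trans (D₊ s) (cong₂ others e e')
    others-capture (suc d) x walk q D q₀ q₊ D₊ close =
      let s , p = others-capture d (x ∘ suc) (walk ∘ suc) (q ∘ suc) (D ∘ suc)
                    (trans (q₊ 0) (cong (λ p → next p (x 0) (x 1)) q₀)) (q₊ ∘ suc) (D₊ ∘ suc) closer
      in suc s , p
      where
      closer : ∀ j → T (near G d (lookup (D 1) j) (lookup (Strategy.start σ) j))
      closer j rewrite D₊ 0 | q₀ | lookup-zipWith (toward d) j (D 0) (Strategy.start σ) = toward-near d _ _ (close j)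

    module _ (N : ℕ) (within : ∀ x y → T (near G N x y)) (l : ℕ) where

      chase : Fin (suc m) → Fin n → Stage → Vec (Fin n) (suc m) → Vec (Fin n) (suc m)
      chase i r q C = insertAt (others q (removeAt C i)) i (toward l (lookup C i) r)

      chase-legal : ∀ i r q C → CopStep G C (chase i r q C)
      chase-legal i r q C = insertAt-legal C _ i (others-legal q (removeAt C i)) (toward-step l _ r)

      chase-near : ∀ i {r} q C → T (near G (suc l) (lookup C i) r) → T (near G l (lookup (chase i r q C) i) r)
      chase-near i {r} q C p =
        subst (λ x → T (near G l x r)) (sym (insertAt-lookup (others q (removeAt C i)) i _)) (toward-near l _ r p)

      -- Ideal pursuit, in which the cops know `x s` when they leave round `s`. Real plays are
      -- matched with it either round by round or one round late.
      pursue : Fin (suc m) → (ℕ → Fin n) → Vec (Fin n) (suc m) → ℕ → Stage × Vec (Fin n) (suc m)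
      pursue i x C zero    = enter N (x 0) , C
      pursue i x C (suc s) = let q , C' = pursue i x C s in next q (x s) (x (suc s)) , chase i (x s) q C'

      pursue-capture : ∀ i x C → (∀ s → Step G (x s) (x (suc s)))
                     → ∃ λ s → x s ∈ proj₂ (pursue i x C s) ⊎ x s ∈ proj₂ (pursue i x C (suc s))
      pursue-capture i x C walk =
        let s , p = others-capture N x walk (proj₁ ∘ pursue i x C) (λ s → removeAt (proj₂ (pursue i x C s)) i)
                      refl (λ s → refl) (λ s → removeAt-insertAt _ i _) (λ j → within _ _)
        in s , Sum.map (∈-removeAt _ i) (∈-removeAt _ i) p

      -- The tail's step lowers the distance bound to `l`, and the target's step raises it by at
      -- most one.
      pursue-near : ∀ i x C → (∀ s → Step G (x s) (x (suc s))) → T (near G (suc l) (lookup C i) (x 0))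
                  → ∀ s → T (near G (suc l) (lookup (proj₂ (pursue i x C s)) i) (x s))
      pursue-near i x C walk p zero    = p
      pursue-near i x C walk p (suc s) =
        let q , C' = pursue i x C s in near-step l (chase-near i q C' (pursue-near i x C walk p s)) (walk s)

      -- Search and pursuit with visibility `suc l`.

      module _ (1≤l : 1 ≤ l) (σˢ : Strategy G (suc m))
               (sees : (w : RobberWalk G) → SeesWithin G (suc l) σˢ (proj₁ w)) where

        vis : Observer G
        vis = visObs G (suc l)

        locate : Vec (Fin n) (suc m) → Fin n → Fin (suc m)
        locate C r with any? (λ j → T? (near G (suc l) (lookup C j) r))
        ... | yes (j , _) = j
        ... | no  _       = zero

        locate-near : ∀ C r → T (anyNear G (suc l) C r) → T (near G (suc l) (lookup C (locate C r)) r)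
        locate-near C r p with any? (λ j → T? (near G (suc l) (lookup C j) r))
        ... | yes (j , q) = q
        ... | no  ¬q      = ⊥-elim (¬q (any-lookup⁻ (λ c → near G (suc l) c r) C p))

        -- In mode current i r q the robber is at r; in mode delayed i r q it
        -- was at r when the cops had just moved, and has moved since.
        data Mode : Set where
          search          : List Obs → Mode
          delayed current : Fin (suc m) → Fin n → Stage → Mode

        spotted : Vec (Fin n) (suc m) → Fin n → Mode
        spotted C r = current (locate C r) r (enter N r)

        -- A sighting after the robber's reply leaves no lag. It therefore replaces `search` or
        -- `delayed` by a fresh pursuit, gathering included, with a cop that sees the robber as
        -- tail.
        update : Mode → Vec (Fin n) (suc m) → Obs → Obs → Mode
        update (search h)      C o         (just r') = spotted C r'
        update (search h)      C (just r)  nothing   = delayed (locate C r) r (enter N r)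
        update (search h)      C nothing   nothing   = search (h ++ nothing ∷ nothing ∷ [])
        update (delayed i r q) C o         (just r') = spotted C r'
        update (delayed i r q) C (just r') nothing   = delayed i r' (next q r r')
        -- A default value: by `pursue-near` the tail sees the position before the reply.
        update (delayed i r q) C nothing   nothing   = delayed i r q
        update (current i r q) C o         (just r') = current i r' (next q r r')
        update (current i r q) C o         nothing   = current i r q

        initial : Obs → Mode
        initial (just r) = spotted (Strategy.start σˢ) r
        initial nothing  = search (nothing ∷ [])

        advance : Mode → Vec (Fin n) (suc m) → Vec (Fin n) (suc m)
        advance (search h)      = Strategy.move σˢ h
        advance (delayed i r q) = chase i r q
        advance (current i r q) = chase i r q

        advance-legal : ∀ s C → CopStep G C (advance s C)
        advance-legal (search h)      = Strategy.legal σˢ h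
        advance-legal (delayed i r q) = chase-legal i r q
        advance-legal (current i r q) = chase-legal i r q

        hunter : Machine (suc m)
        hunter = record
          { Mode = Mode ; start = Strategy.start σˢ ; init = initial
          ; move = advance ; legal = advance-legal ; update = update }

        -- A recurrence without initial condition is invariant under time shift, so captures proved
        -- from round 0 can be reused from any later round.
        Run : (ℕ → Fin n) → (ℕ → Mode × Vec (Fin n) (suc m)) → Set
        Run ρ R = (∀ t → Step G (ρ t) (ρ (suc t))) × (∀ t → R (suc t) ≡ stepOn hunter vis (R t) (ρ t) (ρ (suc t)))

        -- The tail sees the robber after every reply, so the mode stays `current` and the run
        -- coincides with `pursue`.
        current-captures : ∀ ρ R → Run ρ R → ∀ i C → R 0 ≡ (current i (ρ 0) (enter N (ρ 0)) , C)
                         → T (near G (suc l) (lookup C i) (ρ 0)) → CapturesRun hunter vis ρ R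
        current-captures ρ R (walk , R₊) i C R₀ close =
          let s , p = pursue-capture i ρ C walk
          in s , Sum.map (subst (λ p → ρ s ∈ proj₂ p) (sym (follows s)))
                         (subst (λ p → ρ s ∈ proj₂ p) (sym (follows (suc s)))) p
          where
          follows : ∀ s → R s ≡ (current i (ρ s) (proj₁ (pursue i ρ C s)) , proj₂ (pursue i ρ C s))
          follows zero    = R₀
          follows (suc s) = trans (R₊ s) (stepOn-≡ hunter vis (follows s) refl
            (visObs-seen (suc l) (proj₂ (pursue i ρ C (suc s)))
              (anyNear⁺ (suc l) (proj₂ (pursue i ρ C (suc s))) i (pursue-near i ρ C walk close (suc s)))))

        spotted-captures : ∀ ρ R → Run ρ R → ∀ t C → R t ≡ (spotted C (ρ t) , C) → T (anyNear G (suc l) C (ρ t))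
                         → CapturesRun hunter vis ρ R
        spotted-captures ρ R (walk , R₊) t C e p =
          -- With `s + t` rather than `t + s`, the shifted indices at `0` and `suc s` reduce by
          -- computation.
          let s , q = current-captures (λ s → ρ (s + t)) (λ s → R (s + t)) ((λ s → walk (s + t)) , (λ s → R₊ (s + t)))
                        (locate C (ρ t)) C e (locate-near C (ρ t) p)
          in s + t , q

        -- Round `suc s` of the run matches round `s` of `pursue`, hence `R 1` in the hypothesis.
        -- The match lasts until a sighting after a reply, where `spotted-captures` takes over.
        delayed-captures : ∀ ρ R → Run ρ R → ∀ i C → R 1 ≡ (delayed i (ρ 0) (enter N (ρ 0)) , C)
                         → T (near G (suc l) (lookup C i) (ρ 0)) → CapturesRun hunter vis ρ R
        delayed-captures ρ R run@(walk , R₊) i C R₁ close with pursue-capture i ρ C walk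
        ... | s , p = [ (λ c → c) , conclude p ]′ (follows s)
          where
          Lags : ℕ → Set
          Lags s = R (suc s) ≡ (delayed i (ρ s) (proj₁ (pursue i ρ C s)) , proj₂ (pursue i ρ C s))

          spot : ∀ s → Lags s → T (anyNear G (suc l) (proj₂ (pursue i ρ C (suc s))) (ρ (suc (suc s))))
               → CapturesRun hunter vis ρ R
          spot s e seen = spotted-captures ρ R run (suc (suc s)) C'
              (trans (R₊ (suc s)) (stepOn-≡ hunter vis e refl (visObs-seen (suc l) C' seen))) seen
            where
            C' : Vec (Fin n) (suc m)
            C' = proj₂ (pursue i ρ C (suc s))

          follows : ∀ s → CapturesRun hunter vis ρ R ⊎ Lags s
          follows zero    = inj₂ R₁
          follows (suc s) with follows s
          ... | inj₁ c = inj₁ c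
          ... | inj₂ e with T? (anyNear G (suc l) (proj₂ (pursue i ρ C (suc s))) (ρ (suc (suc s))))
          ...   | yes seen   = inj₁ (spot s e seen)
          ...   | no  unseen = inj₂ (trans (R₊ (suc s)) (stepOn-≡ hunter vis e
            (visObs-seen (suc l) (proj₂ (pursue i ρ C (suc s)))
              (anyNear⁺ (suc l) (proj₂ (pursue i ρ C (suc s))) i (pursue-near i ρ C walk close (suc s))))
            (visObs-unseen (suc l) (proj₂ (pursue i ρ C (suc s))) unseen)))

          conclude : ρ s ∈ proj₂ (pursue i ρ C s) ⊎ ρ s ∈ proj₂ (pursue i ρ C (suc s))
                   → Lags s → CapturesRun hunter vis ρ R
          -- Because of the lag, this is a real capture right after the cops' move.
          conclude (inj₁ q) e = s , inj₂ (subst (λ p → ρ s ∈ proj₂ p) (sym e) q)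
          -- A cop of round `s + 2` stands on `ρ s`, two robber moves behind; distance 2 is visible
          -- because `1≤l`.
          conclude (inj₂ q) e = spot s e (anyNear⁺ (suc l) (proj₂ (pursue i ρ C (suc s))) (index q)
            (near-mono (s≤s 1≤l) (near-step 1 (near-step 0 (∈⇒near 0 q) (walk s)) (walk (suc s)))))

        -- Until the first sighting the play is that of `σˢ`, which guarantees one. The pursuit it
        -- starts is delayed exactly when the robber is seen before its reply but not after.
        hunter-captures : ∀ ρ → (∀ t → Step G (ρ t) (ρ (suc t))) → CapturesRun hunter vis ρ (run hunter vis ρ)
        hunter-captures ρ walk with sees (ρ , walk)
        ... | t , p = [ (λ c → c) , conclude p ]′ (follows t)
          where
          R : ℕ → Mode × Vec (Fin n) (suc m)
          R = run hunter vis ρ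

          R-run : Run ρ R
          R-run = walk , λ t → refl

          Searching : ℕ → Set
          Searching t = R t ≡ (search (proj₁ (state G vis σˢ ρ t)) , cops G vis σˢ ρ t)
                      × ¬ T (anyNear G (suc l) (cops G vis σˢ ρ t) (ρ t))

          -- The extra conjunct excludes a sighting between the cops' move and the reply, the second
          -- alternative of `SeesWithin`.
          proceed : ∀ t → Searching t → CapturesRun hunter vis ρ R
                  ⊎ Searching (suc t) × ¬ T (anyNear G (suc l) (cops G vis σˢ ρ (suc t)) (ρ t))
          proceed t (e , _) with T? (anyNear G (suc l) (cops G vis σˢ ρ (suc t)) (ρ (suc t)))
                               | T? (anyNear G (suc l) (cops G vis σˢ ρ (suc t)) (ρ t))
          ... | yes seen | _ = inj₁ (spotted-captures ρ R R-run (suc t) (cops G vis σˢ ρ (suc t))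
            (stepOn-≡ hunter vis e refl (visObs-seen (suc l) (cops G vis σˢ ρ (suc t)) seen)) seen)
          ... | no unseen' | yes seen =
            let C     = cops G vis σˢ ρ (suc t)
                s , q = delayed-captures (λ s → ρ (s + t)) (λ s → R (s + t)) ((λ s → walk (s + t)) , (λ s → refl))
                          (locate C (ρ t)) C
                          (stepOn-≡ hunter vis e (visObs-seen (suc l) C seen) (visObs-unseen (suc l) C unseen'))
                          (locate-near C (ρ t) seen)
            in inj₁ (s + t , q)
          ... | no unseen' | no unseen = inj₂ ((trans (stepOn-≡ hunter vis e o≡ o'≡) stay , unseen') , unseen)
            where
            o≡ : vis (cops G vis σˢ ρ (suc t)) (ρ t) ≡ nothing
            o≡ = visObs-unseen (suc l) (cops G vis σˢ ρ (suc t)) unseen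

            o'≡ : vis (cops G vis σˢ ρ (suc t)) (ρ (suc t)) ≡ nothing
            o'≡ = visObs-unseen (suc l) (cops G vis σˢ ρ (suc t)) unseen'

            stay : (search (proj₁ (state G vis σˢ ρ t) ++ nothing ∷ nothing ∷ []) , cops G vis σˢ ρ (suc t))
                 ≡ (search (proj₁ (state G vis σˢ ρ (suc t))) , cops G vis σˢ ρ (suc t))
            stay = sym (cong₂ (λ o o' → search (proj₁ (state G vis σˢ ρ t) ++ o ∷ o' ∷ []) , cops G vis σˢ ρ (suc t))
                              o≡ o'≡)

          follows : ∀ t → CapturesRun hunter vis ρ R ⊎ Searching t
          follows zero with T? (anyNear G (suc l) (Strategy.start σˢ) (ρ 0))
          ... | yes seen = inj₁ (spotted-captures ρ R R-run 0 (Strategy.start σˢ)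
            (cong (λ o → initial o , Strategy.start σˢ) (visObs-seen (suc l) (Strategy.start σˢ) seen)) seen)
          ... | no unseen = inj₂ (trans (cong (λ o → initial o , Strategy.start σˢ) o≡)
                                        (sym (cong (λ o → search (o ∷ []) , Strategy.start σˢ) o≡)) , unseen)
            where
            o≡ : vis (Strategy.start σˢ) (ρ 0) ≡ nothing
            o≡ = visObs-unseen (suc l) (Strategy.start σˢ) unseen
          follows (suc t) = [ inj₁ , (λ f → map₂ proj₁ (proceed t f)) ]′ (follows t)

          conclude : T (anyNear G (suc l) (cops G vis σˢ ρ t) (ρ t)) ⊎ T (anyNear G (suc l) (cops G vis σˢ ρ (suc t)) (ρ t))
                   → Searching t → CapturesRun hunter vis ρ R
          conclude (inj₁ q) (_ , unseen) = ⊥-elim (unseen q)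
          conclude (inj₂ q) f = [ (λ c → c) , (λ g → ⊥-elim (proj₂ g q)) ]′ (proceed t f)

  -- From sighting and classical capture to capture with visibility.

  canSee⇒canCapture : Connected G → ∀ {l m} → 1 ≤ l → CanCapture G (fullObs G) m → CanSee G (suc l) (suc m)
                    → CanCapture G (visObs G (suc l)) (suc m)
  canSee⇒canCapture conn {l} 1≤l (σ , wins) (σˢ , sees) with uniform-near conn
  ... | N , within = toStrategy (hunter σ wins N within l 1≤l σˢ sees) , λ (ρ , walk) →
    captures-toStrategy _ (visObs G (suc l)) ρ (hunter-captures σ wins N within l 1≤l σˢ sees ρ walk)

  vertex : Connected G → Fin n
  vertex (1≤n , _) = pick 1≤n
    where
    pick : ∀ {k} → 1 ≤ k → Fin k
    pick (s≤s _) = zero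

theorem4p1 : (G : Graph) → Connected G → (ℓ : ℕ) → 2 ≤ ℓ
    → (c cℓ c'ℓ : ℕ) → IsCopNumber G c → IsVisCopNumber G ℓ cℓ → IsVisSeeNumber G ℓ c'ℓ
    → c'ℓ ≡ cℓ ⊎ (c ≤ cℓ × cℓ ≤ c + 1)
theorem4p1 G conn (suc l) (s≤s 1≤l) c cℓ c'ℓ (capᶜ , minᶜ) (capˡ , minˡ) (seeˡ , minˢ) with c'ℓ ≤? suc c
-- Idle cops raise `c'ℓ` to `suc c`: one tail and `c` classical cops.
... | yes c'≤c+1 = inj₂ (minᶜ cℓ (canCapture-vis⇒full G {suc l} capˡ) , subst (cℓ ≤_) (+-comm 1 c) (minˡ (suc c)
        (canSee⇒canCapture G conn 1≤l capᶜ (upward (CanSee G (suc l)) (canSee-suc G {suc l} (vertex G conn)) c'≤c+1 seeˡ))))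
... | no c'≰c+1 with ≰⇒> c'≰c+1
-- Here `c'ℓ` is `suc m` with `m` above `c`, so idle cops extend the classical win to the `m` cops
-- beside the tail.
...   | s≤s c+1≤m = inj₁ (≤-antisym (minˢ cℓ (canCapture⇒canSee G {suc l} capˡ)) (minˡ _ (canSee⇒canCapture G conn 1≤l
        (upward (CanCapture G (fullObs G)) (canCapture-suc G (vertex G conn)) (≤-trans (m≤n+m c 1) c+1≤m) capᶜ) seeˡ)))
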